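{- Assume the continuum hypothesis (CH). Then there is an atomless Boolean algebra $A$ such that $\mathrm{s}_{\mathrm{mm}}(A) = \mathfrak{f}(A) = \omega < \omega_1 = \mathfrak{u}(A)$.
   Context: Let $A$ be a Boolean algebra. A subset $Y\subseteq A$ is ideal-independent if for every $y\in Y$, $y$ does not belong to the ideal of $A$ generated by $Y\setminus\{y\}$. $\mathrm{s}_{\mathrm{mm}}(A)$ is the minimal size of an ideal-independent family of $A$ that is maximal with respect to inclusion. A free sequence in $A$ is a sequence $\{x_\alpha : \alpha<\gamma\}$ of elements of $A$ ($\gamma$ an ordinal) such that whenever $F$ and $G$ are finite subsets of $\gamma$ with $i<j$ for all $i\in F$ and $j\in G$, we have $\left(\prod_{\alpha\in F}x_\alpha\right)\cdot\left(\prod_{\beta\in G}-x_\beta\right)\neq 0$, where empty products equal $1$ by definition. $\mathfrak{f}(A)$ is the minimal size of a free sequence in $A$ that is maximal with respect to end-extension. $\mathfrak{u}(A)$ is the minimal size of a subset of $A$ that generates a nonprincipal ultrafilter of $A$.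
   Formalization: The minimum defining s_mm(A) is taken over infinite maximal ideal-independent families only; read literally, {1} is a maximal ideal-independent family of every nontrivial A, so s_mm(A) could never be ω. -}

module Defs where

open import Level using (Level; 0ℓ; _⊔_; suc; Setω)
open import Algebra.Lattice.Bundles using (BooleanAlgebra)
import Algebra.Lattice.Properties.Lattice as LatticeProperties
open import Data.Bool.Base using (Bool)
open import Data.List.Base using (List; foldr; map)
open import Data.List.Relation.Unary.All using (All)
open import Data.List.Relation.Unary.Enumerates.Setoid using (IsEnumeration)
open import Data.Nat.Base using (ℕ)
open import Data.Product.Base using (Σ; Σ-syntax; ∃; _×_; _,_; proj₁)
open import Data.Sum.Base using (_⊎_)
open import Function.Base using (_∘_)
open import Function.Bundles using (Func; Injection; Inverse)
open import Induction.WellFounded using (WellFounded)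
open import Relation.Binary.Bundles using (Setoid; StrictTotalOrder; Poset)
open import Relation.Binary.Definitions using (_Respects_)
import Relation.Binary.Construct.On as On
open import Relation.Binary.PropositionalEquality using (setoid; _→-setoid_)
open import Relation.Nullary.Negation.Core using (¬_)
open import Relation.Unary using (Pred; _⊆_; _≐_)

private variable
  i p k k′ : Level

-- Choice in its extensional form: the chosen element depends only on the
-- ≈-class of x.  (Without that requirement it is provable in type theory.)
AxiomOfChoice : Setω
AxiomOfChoice =
  {a ℓ b r : Level} (S : Setoid a ℓ) (B : Set b)
  (R : Setoid.Carrier S → B → Set r) →
  (∀ y → (λ x → R x y) Respects (Setoid._≈_ S)) →
  (∀ x → ∃ (R x)) →
  Σ[ f ∈ Func S (setoid B) ] ∀ x → R x (Func.to f x)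

-- Sets, with their equality, are setoids.

∣_∣ : {S : Setoid 0ℓ 0ℓ} → Pred (Setoid.Carrier S) 0ℓ → Setoid 0ℓ 0ℓ
∣_∣ {S} P = On.setoid {B = Σ (Setoid.Carrier S) P} S proj₁

_≲_ : Setoid 0ℓ 0ℓ → Setoid 0ℓ 0ℓ → Set
X ≲ Y = Injection X Y

Finite : Setoid 0ℓ 0ℓ → Set
Finite X = ∃ (IsEnumeration X)

Countable : Setoid 0ℓ 0ℓ → Set
Countable X = X ≲ setoid ℕ

record Ordinal : Set₁ where
  field
    strictTotalOrder : StrictTotalOrder 0ℓ 0ℓ 0ℓ
  open StrictTotalOrder strictTotalOrder public
    using (Carrier; _≈_; _<_)
  field
    wellFounded : WellFounded _<_

  underlying : Setoid 0ℓ 0ℓ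
  underlying = StrictTotalOrder.Eq.setoid strictTotalOrder

  Below : Carrier → Setoid 0ℓ 0ℓ
  Below a = ∣_∣ {underlying} (_< a)

-- The least uncountable ordinal, determined up to order isomorphism.
IsOmega₁ : Ordinal → Set
IsOmega₁ γ = ¬ Countable (Ordinal.underlying γ)
           × (∀ a → Countable (Ordinal.Below γ a))

-- A cardinal is represented by the class of all sets having that size.
Cardinal : (k : Level) → Set (suc 0ℓ ⊔ suc k)
Cardinal k = Pred (Setoid 0ℓ 0ℓ) k

ω : Cardinal 0ℓ
ω X = Inverse X (setoid ℕ)

ω₁ : Cardinal (suc 0ℓ)
ω₁ X = Σ[ γ ∈ Ordinal ] IsOmega₁ γ × Inverse X (Ordinal.underlying γ)

_<ᶜ_ : Cardinal k → Cardinal k′ → Set (suc 0ℓ ⊔ k ⊔ k′)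
κ <ᶜ μ = ∀ X Y → κ X → μ Y → X ≲ Y × ¬ (Y ≲ X)

-- 2^ω = ω₁; functions ℕ → Bool are compared pointwise.
ContinuumHypothesis : Set₁
ContinuumHypothesis = ω₁ (ℕ →-setoid Bool)

-- κ is the least size of a member of the family P.
IsMinimalSize : {I : Set i} (size : I → Setoid 0ℓ 0ℓ) →
                Pred I p → Cardinal k → Set (i ⊔ p ⊔ k)
IsMinimalSize size P κ =
  ∃ λ x → P x × κ (size x) × (∀ y → P y → size x ≲ size y)

module _ (A : BooleanAlgebra 0ℓ 0ℓ) where
  open BooleanAlgebra A
    renaming (¬_ to infix 8 -_; ⊤ to 1#; ⊥ to 0#; setoid to A-setoid)
  open Poset (LatticeProperties.poset lattice) using (_≤_)

  IsAtom : Pred Carrier 0ℓ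
  IsAtom a = a ≉ 0# × (∀ b → b ≤ a → b ≈ 0# ⊎ b ≈ a)

  Atomless : Set
  Atomless = ∀ a → ¬ IsAtom a

  record Subset : Set₁ where
    field
      Member : Pred Carrier 0ℓ
      resp   : Member Respects _≈_

    asSetoid : Setoid 0ℓ 0ℓ
    asSetoid = ∣_∣ {A-setoid} Member

  open Subset

  data Ideal⟨_⟩ (S : Pred Carrier 0ℓ) : Pred Carrier 0ℓ where
    generator : ∀ {a} → S a → Ideal⟨ S ⟩ a
    bottom    : Ideal⟨ S ⟩ 0#
    join      : ∀ {a b} → Ideal⟨ S ⟩ a → Ideal⟨ S ⟩ b → Ideal⟨ S ⟩ (a ∨ b)
    down      : ∀ {a b} → a ≤ b → Ideal⟨ S ⟩ b → Ideal⟨ S ⟩ a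

  data Filter⟨_⟩ (S : Pred Carrier 0ℓ) : Pred Carrier 0ℓ where
    generator : ∀ {a} → S a → Filter⟨ S ⟩ a
    top       : Filter⟨ S ⟩ 1#
    meet      : ∀ {a b} → Filter⟨ S ⟩ a → Filter⟨ S ⟩ b → Filter⟨ S ⟩ (a ∧ b)
    up        : ∀ {a b} → a ≤ b → Filter⟨ S ⟩ a → Filter⟨ S ⟩ b

  IdealIndependent : Pred Subset 0ℓ
  IdealIndependent Y =
    ∀ y → Member Y y → ¬ Ideal⟨ (λ a → Member Y a × a ≉ y) ⟩ y

  MaximalIdealIndependent : Pred Subset (suc 0ℓ)
  MaximalIdealIndependent Y =
    IdealIndependent Y
    × (∀ Z → IdealIndependent Z → Member Y ⊆ Member Z → Member Z ⊆ Member Y)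

  -- Only infinite families are considered: {1} is always a maximal
  -- ideal-independent family when 0 ≠ 1, as is every finite partition of
  -- unity, so the minimum over all families would be trivial.
  IsSmm : Cardinal k → Set (suc 0ℓ ⊔ k)
  IsSmm = IsMinimalSize asSetoid
    (λ Y → ¬ Finite (asSetoid Y) × MaximalIdealIndependent Y)

  ∏ : List Carrier → Carrier
  ∏ = foldr _∧_ 1#

  record FreeSequence : Set₁ where
    field
      length : Ordinal
      terms  : Func (Ordinal.underlying length) A-setoid
    open Ordinal length using (_<_) renaming (Carrier to Index)
    open Func terms public using () renaming (to to term)
    field
      free : (F G : List Index) → All (λ α → All (α <_) G) F →
             ∏ (map term F) ∧ ∏ (map (λ β → - term β) G) ≉ 0#

  -- y end-extends x: up to isomorphism, x is the restriction of y to an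
  -- initial segment of its index ordinal.
  record _EndExtends_ (y x : FreeSequence) : Set where
    private
      module X = FreeSequence x
      module Y = FreeSequence y
      module γ = Ordinal X.length
      module δ = Ordinal Y.length
    field
      embedding : Func γ.underlying δ.underlying
    open Func embedding public using () renaming (to to embed)
    field
      monotone       : ∀ {α β} → α γ.< β → embed α δ.< embed β
      initialSegment : ∀ {α β} → β δ.< embed α → ∃ λ α′ → embed α′ δ.≈ β
      agrees         : ∀ α → Y.term (embed α) ≈ X.term α

  MaximalFreeSequence : Pred FreeSequence (suc 0ℓ)
  MaximalFreeSequence x =
    ∀ y (e : y EndExtends x) (β : Ordinal.Carrier (FreeSequence.length y)) →
    ∃ λ α → Ordinal._≈_ (FreeSequence.length y) (_EndExtends_.embed e α) β

  -- The terms of a free sequence are pairwise distinct, so its size is that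
  -- of its index ordinal.
  IsF : Cardinal k → Set (suc 0ℓ ⊔ k)
  IsF = IsMinimalSize (Ordinal.underlying ∘ FreeSequence.length)
    MaximalFreeSequence

  record IsProperFilter (U : Pred Carrier 0ℓ) : Set where
    field
      has-1  : U 1#
      ∧-clos : ∀ {a b} → U a → U b → U (a ∧ b)
      ↑-clos : ∀ {a b} → a ≤ b → U a → U b
      proper : ¬ U 0#

  IsUltrafilter : Pred (Pred Carrier 0ℓ) (suc 0ℓ)
  IsUltrafilter U =
    IsProperFilter U × (∀ V → IsProperFilter V → U ⊆ V → V ⊆ U)

  IsPrincipal : Pred (Pred Carrier 0ℓ) 0ℓ
  IsPrincipal U = ∃ λ a → U ≐ (a ≤_)

  GeneratesNonprincipalUltrafilter : Pred Subset (suc 0ℓ)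
  GeneratesNonprincipalUltrafilter S =
    IsUltrafilter Filter⟨ Member S ⟩ × ¬ IsPrincipal Filter⟨ Member S ⟩

  IsU : Cardinal k → Set (suc 0ℓ ⊔ k)
  IsU = IsMinimalSize asSetoid GeneratesNonprincipalUltrafilter

{-# OPTIONS --safe #-}
module Submission where

open import Defs
open import Level using (0ℓ; Setω)
open import Algebra.Lattice.Bundles using (BooleanAlgebra)
open import Axiom.ExcludedMiddle using (ExcludedMiddle)
open import Data.Product.Base using (Σ-syntax; _×_)

import Algebra.Lattice.Properties.BooleanAlgebra as BAₚ
import Algebra.Lattice.Properties.Lattice as LatticeProperties
import Data.Bool.Properties as Bool
open import Data.Empty using (⊥-elim)
open import Data.Fin.Base using (Fin; toℕ; fromℕ<)
open import Data.Fin.Properties using (toℕ<n; toℕ-fromℕ<; toℕ-injective)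
open import Data.List.Base using (List; []; _∷_; lookup; map; tabulate)
open import Data.List.Extrema.Nat using (max; xs≤max)
open import Data.List.Membership.Setoid.Properties using (∈-tabulate⁺)
open import Data.List.Relation.Unary.All as All using (All; []; _∷_)
import Data.List.Relation.Unary.All.Properties as Allₚ
open import Data.List.Relation.Unary.Any as Any using (Any)
import Data.List.Relation.Unary.Any.Properties as Anyₚ
open import Data.Nat.Base using (ℕ; zero; suc)
import Data.Nat.Base as ℕ
import Data.Nat.Induction as ℕ
import Data.Nat.Properties as ℕ
open import Data.Product.Base using (∃; _,_; proj₁; proj₂)
open import Data.Sum.Base using (_⊎_; inj₁; inj₂)
open import Function.Base using (_∘_; _on_; id)
open import Function.Bundles using (Func; Injection; Inverse)
import Function.Construct.Composition as Compose
import Function.Construct.Identity as Identity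
import Function.Construct.Symmetry as Symmetry
open import Function.Properties.Inverse using (Inverse⇒Injection)
open import Induction.WellFounded using (Acc; acc)
open import Relation.Binary.Bundles using (Setoid; StrictTotalOrder)
import Relation.Binary.Construct.Add.Point.Equality as PointEquality
import Relation.Binary.Construct.Add.Supremum.Strict as StrictSupremum
import Relation.Binary.Construct.On as On
open import Relation.Binary.Definitions using (Tri; tri<; tri≈; tri>)
open import Relation.Binary.Lattice using () renaming (module Lattice to OrderLattice)
open import Relation.Binary.PropositionalEquality as ≡ using (_≡_; _≢_; _→-setoid_; refl; setoid)
open import Relation.Nullary.Construct.Add.Supremum using (_⁺; [_]; ⊤⁺)
open import Relation.Nullary.Decidable using (decidable-stable; does; dec-true)
open import Relation.Nullary.Decidable.Core using (Dec; yes; no)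
open import Relation.Nullary.Negation.Core using (¬_; contradiction)
open import Relation.Unary using (Pred; _⊆_)
open import Relation.Unary.Relation.Binary.Equality using (≐-setoid)

-- Let A consist of the sequences in the power (P(ω)/fin)^ω almost all of whose
-- entries are 0 or 1, and let yₙ be 1 at n and 0 elsewhere.  An element of A
-- with infinitely many nonzero entries lies above some yₙ, and every other one
-- belongs to the ideal generated by the yₙ.  Hence {yₙ} is a maximal
-- ideal-independent family, and the elements -(y₀ ∨ … ∨ yₙ) form a maximal
-- free sequence; no finite free sequence is maximal because A is atomless.
--
-- Let u be a decreasing sequence of nonzero elements.  Either some coordinate
-- is nonzero in every uₖ, or each uₖ has infinitely many coordinates equal to
-- 1.  Since countably many decreasing infinite subsets of ω are split by a
-- single set, in both cases some c has uₖ ∧ c ≠ 0 and uₖ ∧ - c ≠ 0 for all k.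
-- So no ultrafilter of A is countably generated.  As A has size 2^ω, CH gives
-- 𝔲(A) = ω₁.

-- Ordinals and cardinalities under excluded middle and choice.

EM : Setω
EM = ∀ {ℓ} → ExcludedMiddle ℓ

¬∀⇒∃¬ : EM → ∀ {a p} {X : Set a} {P : X → Set p} → ¬ (∀ x → P x) → ∃ λ x → ¬ P x
¬∀⇒∃¬ em ¬all = decidable-stable em λ ¬∃ →
  ¬all λ x → decidable-stable em λ ¬Px → ¬∃ (x , ¬Px)

ωₒ : Ordinal
ωₒ = record
  { strictTotalOrder = ℕ.<-strictTotalOrder
  ; wellFounded      = ℕ.<-wellFounded
  }

-- The pulled-back order keeps `X` itself as underlying setoid, so the bijection demanded by `ω₁ X`
-- can later be the identity.
onInjection : (γ : Ordinal) {X : Setoid 0ℓ 0ℓ} → X ≲ Ordinal.underlying γ → Ordinal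
onInjection γ {X} ι = record
  { strictTotalOrder = record
    { _≈_ = _≈_
    ; _<_ = _<_ on to
    ; isStrictTotalOrder = record
      { isStrictPartialOrder = record
        { isEquivalence = isEquivalence
        ; irrefl        = λ x≈y → γ.irrefl (cong x≈y)
        ; trans         = γ.trans
        ; <-resp-≈      = (λ y≈z → γ.<-respʳ-≈ (cong y≈z)) , (λ y≈z → γ.<-respˡ-≈ (cong y≈z))
        }
      ; compare = compare
      }
    }
  ; wellFounded = On.wellFounded to (Ordinal.wellFounded γ)
  }
  where
  open Setoid X using (_≈_; isEquivalence)
  open Injection ι using (to; cong; injective)
  module γ = StrictTotalOrder (Ordinal.strictTotalOrder γ)
  open γ using (_<_)
  compare : ∀ x y → _
  compare x y with γ.compare (to x) (to y)
  ... | tri< p q r = tri< p (q ∘ cong) r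
  ... | tri≈ p q r = tri≈ p (injective q) r
  ... | tri> p q r = tri> p (q ∘ cong) r

Finite-resp-↔ : {X Y : Setoid 0ℓ 0ℓ} → Inverse X Y → Finite X → Finite Y
Finite-resp-↔ X↔Y (xs , enum) = map to xs , λ y →
  Anyₚ.map⁺ (Any.map (λ y≈x → Eq₂.trans (Eq₂.sym (strictlyInverseˡ y)) (to-cong y≈x)) (enum (from y)))
  where
  open Inverse X↔Y

ℕ-infinite : ¬ Finite (setoid ℕ)
ℕ-infinite (xs , enum) =
  ℕ.<-irrefl refl (All.lookup (xs≤max 0 xs) (enum (suc (max 0 xs))))

-- Equal elements may occur at several positions of the list; extensional choice picks one position
-- per class, and looking it up recovers the element up to `≈`.
Finite⇒Countable : EM → AxiomOfChoice → {X : Setoid 0ℓ 0ℓ} → Finite X → Countable X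
Finite⇒Countable em ac {X} (xs , enum) = record
  { to        = λ x → toℕ (to x)
  ; cong      = λ x≈y → ≡.cong toℕ (cong x≈y)
  ; injective = λ {x} {y} eq → trans (sym (chosen x))
      (trans (reflexive (≡.cong (lookup xs) (toℕ-injective eq))) (chosen y))
  }
  where
  open Setoid X
  choice = ac X (Fin _) (λ x i → lookup xs i ≈ x) (λ i x≈y eq → trans eq x≈y)
              (λ x → Any.index (enum x) , sym (Anyₚ.lookup-index (enum x)))
  open Func (proj₁ choice)
  chosen = proj₂ choice

¬Finite⇒inhabited : EM → {X : Setoid 0ℓ 0ℓ} → ¬ Finite X → Setoid.Carrier X
¬Finite⇒inhabited em ¬fin = proj₁ (¬∀⇒∃¬ em λ enum → ¬fin ([] , enum))

Onto : {X Y : Setoid 0ℓ 0ℓ} → Func X Y → Set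
Onto {Y = Y} f = ∀ y → ∃ λ x → Setoid._≈_ Y (Func.to f x) y

module Embedding
  (em : EM) (ac : AxiomOfChoice) (γ : Ordinal) (X : Setoid 0ℓ 0ℓ)
  (x₀ : Setoid.Carrier X)
  (¬onto : ∀ α (f : Func (Ordinal.Below γ α) X) → ¬ Onto f)
  where

  open Setoid X using () renaming (Carrier to C; _≈_ to _≋_)
  module X = Setoid X
  module γ = StrictTotalOrder (Ordinal.strictTotalOrder γ)
  open γ using (_<_; _≈_)
  open Ordinal γ using (wellFounded)

  -- One choice function serves all predicates, with `x₀` as default for empty ones. Taking `≐` as
  -- equality of predicates makes the choice depend only on the extension.
  choice : Σ[ f ∈ Func (≐-setoid C 0ℓ) (setoid C) ] ∀ P → ∃ P → P (Func.to f P)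
  choice = ac (≐-setoid C 0ℓ) C (λ P x → ∃ P → P x)
              (λ x P≐Q h ∃Q → proj₁ P≐Q (h (proj₁ ∃Q , proj₂ P≐Q (proj₂ ∃Q))))
              (λ P → witness P em)
    where
    witness : ∀ P → Dec (∃ P) → ∃ λ x → ∃ P → P x
    witness P (yes (x , Px)) = x , λ _ → Px
    witness P (no ¬∃)        = x₀ , ⊥-elim ∘ ¬∃

  open Func (proj₁ choice) using () renaming (to to pick; cong to pick-cong)

  g : ∀ α → Acc _<_ α → C
  g α (acc rs) = pick λ x → ∀ β (β<α : β < α) → ¬ g β (rs β<α) ≋ x

  -- Different accessibility proofs yield extensionally equal sets of admissible values, on which
  -- `pick` agrees.
  g-cong : ∀ {α α′} p q → α ≈ α′ → g α p ≡ g α′ q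
  g-cong {α} {α′} (acc rs) (acc rs′) α≈α′ = pick-cong
    ( (λ avoids β β<α′ eq → let β<α = γ.<-respʳ-≈ (γ.Eq.sym α≈α′) β<α′ in
        avoids β β<α (X.trans (X.reflexive (g-cong (rs β<α) (rs′ β<α′) γ.Eq.refl)) eq))
    , (λ avoids β β<α eq → let β<α′ = γ.<-respʳ-≈ α≈α′ β<α in
        avoids β β<α′ (X.trans (X.reflexive (g-cong (rs′ β<α′) (rs β<α) γ.Eq.refl)) eq)))

  embed : γ.Carrier → C
  embed α = g α (wellFounded α)

  embed-cong : ∀ {α β} → α ≈ β → embed α ≋ embed β
  embed-cong = X.reflexive ∘ g-cong (wellFounded _) (wellFounded _)

  below : ∀ α → Func (Ordinal.Below γ α) X
  below α = record { to = embed ∘ proj₁ ; cong = embed-cong }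

  -- `¬onto` leaves a value outside the image of `below α`, so the predicate given to `pick` is
  -- inhabited and the picked value satisfies it.
  g-fresh : ∀ {α β} p → β < α → ¬ embed β ≋ g α p
  g-fresh {α} {β} (acc rs) β<α eq = proj₂ choice _ fresh β β<α
    (X.trans (X.reflexive (g-cong (rs β<α) (wellFounded β) γ.Eq.refl)) eq)
    where
    fresh : ∃ λ x → ∀ β (β<α : β < α) → ¬ g β (rs β<α) ≋ x
    fresh with x , unhit ← ¬∀⇒∃¬ em (¬onto α (below α)) = x , λ β β<α eq →
      unhit ((β , β<α) , X.trans (X.reflexive (g-cong (wellFounded β) (rs β<α) γ.Eq.refl)) eq)

  embedding : Ordinal.underlying γ ≲ X
  embedding = record
    { to        = embed
    ; cong      = embed-cong
    ; injective = λ {α} {β} eq → injective eq (γ.compare α β)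
    }
    where
    injective : ∀ {α β} → embed α ≋ embed β → Tri (α < β) (α ≈ β) (β < α) → α ≈ β
    injective {β = β} eq (tri< α<β _ _) = contradiction eq (g-fresh (wellFounded β) α<β)
    injective eq (tri≈ _ α≈β _) = α≈β
    injective {α} eq (tri> _ _ β<α) = contradiction (X.sym eq) (g-fresh (wellFounded α) β<α)

-- A map from an initial segment of `ℕ` onto `X` would, once tabulated, enumerate `X`.
¬Finite⇒ℕ≲ : EM → AxiomOfChoice → {X : Setoid 0ℓ 0ℓ} → ¬ Finite X → setoid ℕ ≲ X
¬Finite⇒ℕ≲ em ac {X} ¬fin = Embedding.embedding em ac ωₒ X (¬Finite⇒inhabited em {X} ¬fin)
  λ n f onto → ¬fin (tabulate (value n f) , λ x → enumerates n f x (onto x))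
  where
  open Setoid X
  value : ∀ n → Func (Ordinal.Below ωₒ n) X → Fin n → Carrier
  value n f i = Func.to f (toℕ i , toℕ<n i)
  enumerates : ∀ n f x → (∃ λ m → Func.to f m ≈ x) → Any (x ≈_) (tabulate (value n f))
  enumerates n f x ((m , m<n) , fm≈x) = Any.map (trans (sym (trans (Func.cong f (toℕ-fromℕ< m<n)) fm≈x)))
    (∈-tabulate⁺ X (fromℕ< m<n))

-- If X were the image of an initial segment, which is countable, then it
-- would be countable itself.
¬Countable⇒ω₁≲ : EM → AxiomOfChoice → (γ : Ordinal) → IsOmega₁ γ →
                 {X : Setoid 0ℓ 0ℓ} → ¬ Countable X → Ordinal.underlying γ ≲ X
¬Countable⇒ω₁≲ em ac γ (_ , below-countable) {X} ¬count =
  Embedding.embedding em ac γ X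
    (¬Finite⇒inhabited em {X} (¬count ∘ Finite⇒Countable em ac {X}))
    λ α f onto → ¬count (countable α f onto)
  where
  open Setoid X
  countable : ∀ α (f : Func (Ordinal.Below γ α) X) → Onto f → Countable X
  countable α f onto = record
    { to        = to
    ; cong      = cong
    ; injective = λ {x} {y} eq →
        let (_ , i≡ , b≈x) = proj₂ choice x
            (_ , j≡ , c≈y) = proj₂ choice y
        in trans (sym b≈x) (trans (Func.cong f (injective (≡.trans i≡ (≡.trans eq (≡.sym j≡))))) c≈y)
    }
    where
    open Injection (below-countable α) using (injective) renaming (to to index)
    choice = ac X ℕ (λ x n → ∃ λ b → index b ≡ n × Func.to f b ≈ x)
                (λ n x≈y (b , i , e) → b , i , trans e x≈y)
                (λ x → index (proj₁ (onto x)) , proj₁ (onto x) , ≡.refl , proj₂ (onto x))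
    open Func (proj₁ choice)

ω<ω₁ : EM → AxiomOfChoice → ω <ᶜ ω₁
ω<ω₁ em ac X Y X↔ℕ (γ , (¬count , below) , Y↔γ) =
    Compose.injection (Inverse⇒Injection X↔ℕ) (¬Finite⇒ℕ≲ em ac {Y} (¬Y ∘ Finite⇒Countable em ac {Y}))
  , λ Y≲X → ¬Y (Compose.injection Y≲X (Inverse⇒Injection X↔ℕ))
  where
  ¬Y : ¬ Countable Y
  ¬Y = ¬count ∘ Compose.injection (Inverse⇒Injection (Symmetry.inverse Y↔γ))

-- Initial segments of the pulled-back order inject into those of `γ`, which are countable.
≲ω₁-uncountable⇒ω₁ : (γ : Ordinal) → IsOmega₁ γ → {X : Setoid 0ℓ 0ℓ} →
  X ≲ Ordinal.underlying γ → ¬ Countable X → ω₁ X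
≲ω₁-uncountable⇒ω₁ γ (_ , below) {X} ι ¬count =
    onInjection γ {X} ι
  , (¬count , λ a → Compose.injection (restrict a) (below (to a)))
  , Identity.inverse X
  where
  open Injection ι
  restrict : ∀ a → Ordinal.Below (onInjection γ {X} ι) a ≲ Ordinal.Below γ (to a)
  restrict a = record { to = λ (x , x<a) → to x , x<a ; cong = cong ; injective = injective }

-- Order and filters in a Boolean algebra.

module BooleanFacts (A : BooleanAlgebra 0ℓ 0ℓ) where

  open BooleanAlgebra A public
    renaming ( ¬_ to infix 8 -_; ⊤ to 1#; ⊥ to 0#; setoid to A-setoid
             ; refl to ≈-refl; sym to ≈-sym; trans to ≈-trans; reflexive to ≈-reflexive )
  open BAₚ A public using (∧-zeroʳ; ∧-identityʳ; deMorgan₁; ¬-involutive)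
  open OrderLattice (LatticeProperties.∨-∧-orderTheoreticLattice lattice) public
    using (_≤_; x∧y≤x; x∧y≤y; ∧-greatest; x≤x∨y; y≤x∨y; ∨-least; ≤-respˡ-≈; ≤-respʳ-≈)
    renaming (refl to ≤-refl; reflexive to ≤-reflexive; trans to ≤-trans)

  Filter Ideal : Pred Carrier 0ℓ → Pred Carrier 0ℓ
  Filter = Filter⟨_⟩ A
  Ideal  = Ideal⟨_⟩ A

  ≤1 : ∀ x → x ≤ 1#
  ≤1 x = ≈-sym (∧-identityʳ x)

  0≤ : ∀ x → 0# ≤ x
  0≤ x = ≈-sym (≈-trans (∧-comm 0# x) (∧-zeroʳ x))

  ≤0⇒≈0 : ∀ {x} → x ≤ 0# → x ≈ 0#
  ≤0⇒≈0 {x} x≤0 = ≈-trans x≤0 (∧-zeroʳ x)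

  ≤-≉0 : ∀ {x y} → x ≤ y → x ≉ 0# → y ≉ 0#
  ≤-≉0 x≤y x≉0 y≈0 = x≉0 (≤0⇒≈0 (≤-respʳ-≈ y≈0 x≤y))

  ≤-∧- : ∀ {x y} → x ≤ y → x ≤ - y → x ≈ 0#
  ≤-∧- {x} {y} x≤y x≤-y = ≤0⇒≈0 (≤-respʳ-≈ (∧-complementʳ y) (∧-greatest x≤y x≤-y))

  -‿antitone : ∀ {x y} → x ≤ y → - y ≤ - x
  -‿antitone {x} {y} x≤y =
    ≤-trans (y≤x∨y (- x) (- y)) (≤-reflexive (≈-sym (≈-trans (¬-cong x≤y) (deMorgan₁ x y))))

  ≤-⇒≤- : ∀ {x y} → x ≤ - y → y ≤ - x
  ≤-⇒≤- {x} {y} x≤-y = ≤-respˡ-≈ (¬-involutive y) (-‿antitone x≤-y)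

  ∏-greatest : ∀ {c xs} → All (c ≤_) xs → c ≤ ∏ A xs
  ∏-greatest []       = ≤1 _
  ∏-greatest (p ∷ ps) = ∧-greatest p (∏-greatest ps)

  ∏-lower : ∀ xs → All (∏ A xs ≤_) xs
  ∏-lower []       = []
  ∏-lower (x ∷ xs) = x∧y≤x _ _ ∷ All.map (≤-trans (x∧y≤y _ _)) (∏-lower xs)

  Filter-bind : ∀ {S T} → S ⊆ Filter T → Filter S ⊆ Filter T
  Filter-bind h (generator s) = h s
  Filter-bind h top           = top
  Filter-bind h (meet p q)    = meet (Filter-bind h p) (Filter-bind h q)
  Filter-bind h (up a≤b p)    = up a≤b (Filter-bind h p)

  Filter-least : ∀ {S V} → IsProperFilter A V → S ⊆ V → Filter S ⊆ V
  Filter-least V-filter h (generator s) = h s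
  Filter-least V-filter h top           = IsProperFilter.has-1 V-filter
  Filter-least V-filter h (meet p q)    =
    IsProperFilter.∧-clos V-filter (Filter-least V-filter h p) (Filter-least V-filter h q)
  Filter-least V-filter h (up a≤b p)    = IsProperFilter.↑-clos V-filter a≤b (Filter-least V-filter h p)

  -- Splitting and the size of ultrafilter bases.

  meets : (ℕ → Carrier) → ℕ → Carrier
  meets e zero    = 1#
  meets e (suc k) = meets e k ∧ e k

  meets-antitone : ∀ e {k l} → k ℕ.≤′ l → meets e l ≤ meets e k
  meets-antitone e ℕ.≤′-refl       = ≤-refl
  meets-antitone e (ℕ.≤′-step k≤l) = ≤-trans (x∧y≤x _ _) (meets-antitone e k≤l)

  meets-⊔ˡ : ∀ e k l → meets e (k ℕ.⊔ l) ≤ meets e k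
  meets-⊔ˡ e k l = meets-antitone e (ℕ.≤⇒≤′ (ℕ.m≤m⊔n k l))

  meets-⊔ʳ : ∀ e k l → meets e (k ℕ.⊔ l) ≤ meets e l
  meets-⊔ʳ e k l = meets-antitone e (ℕ.≤⇒≤′ (ℕ.m≤n⊔m k l))

  -- Phrased with the partial meets of an arbitrary sequence, so that it applies to any countable
  -- list of filter generators: the partial meets are a base of the generated filter.
  Splitting : Set
  Splitting = ∀ e → (∀ k → meets e k ≉ 0#) →
              ∃ λ c → ∀ k → meets e k ∧ c ≉ 0# × meets e k ∧ - c ≉ 0#

  -- Splitting is applied to the constant sequence `p`. Stage `1` is used because stage `0` is the
  -- empty meet `1#`.
  split : Splitting → ∀ {p} → p ≉ 0# → ∃ λ c → p ∧ c ≉ 0# × p ∧ - c ≉ 0#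
  split splitting {p} p≉0 =
    let (c , splits) = splitting (λ _ → p) (λ k → ≤-≉0 (below k) p≉0)
    in c , ≤-≉0 meets₁≤p (proj₁ (splits 1)) , ≤-≉0 meets₁≤p (proj₂ (splits 1))
    where
    below : ∀ k → p ≤ meets (λ _ → p) k
    below zero    = ≤1 p
    below (suc k) = ∧-greatest (below k) ≤-refl
    meets₁≤p : ∀ {d} → (1# ∧ p) ∧ d ≤ p ∧ d
    meets₁≤p = ∧-greatest (≤-trans (x∧y≤x _ _) (x∧y≤y _ _)) (x∧y≤y _ _)

  atomless : Splitting → Atomless A
  atomless splitting a (a≉0 , minimal) with c , a∧c≉0 , a∧-c≉0 ← split splitting a≉0
    with minimal (a ∧ c) (x∧y≤x a c)
  ... | inj₁ a∧c≈0 = a∧c≉0 a∧c≈0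
  ... | inj₂ a∧c≈a = a∧-c≉0 (≤-∧-
          (≤-trans (x∧y≤x _ _) (≤-trans (≤-reflexive (≈-sym a∧c≈a)) (x∧y≤y a c))) (x∧y≤y _ _))

  -- An element splitting the whole base is compatible with the ultrafilter
  -- but does not belong to it.
  no-countable-base : Splitting → ∀ {U} → IsUltrafilter A U → (e : ℕ → Carrier) →
                      (∀ k → U (e k)) → ¬ (∀ {a} → U a → ∃ λ k → meets e k ≤ a)
  no-countable-base splitting {U} (U-filter , U-maximal) e e∈U base = contra (base c∈U)
    where
    open IsProperFilter U-filter
    meets∈U : ∀ k → U (meets e k)
    meets∈U zero    = has-1
    meets∈U (suc k) = ∧-clos (meets∈U k) (e∈U k)
    splitter : ∃ λ c → ∀ k → meets e k ∧ c ≉ 0# × meets e k ∧ - c ≉ 0#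
    splitter = splitting e λ k meets≈0 → proper (↑-clos (≤-reflexive meets≈0) (meets∈U k))
    c : Carrier
    c = proj₁ splitter
    splits : ∀ k → meets e k ∧ c ≉ 0# × meets e k ∧ - c ≉ 0#
    splits = proj₂ splitter
    V : Pred Carrier 0ℓ
    V b = ∃ λ k → meets e k ∧ c ≤ b
    V-filter : IsProperFilter A V
    V-filter = record
      { has-1  = 0 , ≤1 _
      ; ∧-clos = λ (k , p) (l , q) → k ℕ.⊔ l ,
          ∧-greatest (≤-trans (∧-greatest (≤-trans (x∧y≤x _ _) (meets-⊔ˡ e k l)) (x∧y≤y _ _)) p)
                     (≤-trans (∧-greatest (≤-trans (x∧y≤x _ _) (meets-⊔ʳ e k l)) (x∧y≤y _ _)) q)
      ; ↑-clos = λ a≤b (k , p) → k , ≤-trans p a≤b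
      ; proper = λ (k , p) → proj₁ (splits k) (≤0⇒≈0 p)
      }
    c∈U : U c
    c∈U = U-maximal V V-filter (λ a∈U → let (k , p) = base a∈U in k , ≤-trans (x∧y≤x _ _) p)
                    (0 , x∧y≤y _ _)
    contra : ¬ ∃ λ k → meets e k ≤ c
    contra (k , p) = proj₂ (splits k) (≤-∧- (≤-trans (x∧y≤x _ _) p) (x∧y≤y _ _))

  -- The constant sequence at the least element of a principal ultrafilter would give a countable
  -- base.
  ultrafilter-nonprincipal : Splitting → ∀ {U} → IsUltrafilter A U → ¬ IsPrincipal A U
  ultrafilter-nonprincipal splitting U-ultra (a , U⊆ , ⊆U) =
    no-countable-base splitting U-ultra (λ _ → a) (λ _ → ⊆U ≤-refl)
      (λ b∈U → 1 , ≤-trans (x∧y≤y _ _) (U⊆ b∈U))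

  -- An injection into `ℕ` would list the generators, and their finite meets would form a countable
  -- base.
  generators-uncountable : EM → Splitting → (T : Subset A) →
    IsUltrafilter A (Filter (Subset.Member T)) → ¬ Countable (Subset.asSetoid T)
  generators-uncountable em splitting T U-ultra ι =
    no-countable-base splitting U-ultra e e∈U base
    where
    open Subset T
    open Injection ι
    nth : ∀ {k} → Dec (∃ λ t → to t ≡ k) → Carrier
    nth (yes ((a , _) , _)) = a
    -- Indices outside the range of the injection get `1#`, which lies in every filter and leaves
    -- meets unchanged.
    nth (no _)              = 1#
    e : ℕ → Carrier
    e k = nth {k} em
    nth∈U : ∀ {k} (d : Dec (∃ λ t → to t ≡ k)) → Filter Member (nth d)
    nth∈U (yes ((_ , a∈T) , _)) = generator a∈T
    nth∈U (no _)                = top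
    e∈U : ∀ k → Filter Member (e k)
    e∈U k = nth∈U {k} em
    nth-to : ∀ t (d : Dec (∃ λ s → to s ≡ to t)) → nth d ≤ proj₁ t
    nth-to t (yes (s , eq)) = ≤-reflexive (injective {s} {t} eq)
    nth-to t (no ¬∃)        = contradiction (t , refl) ¬∃
    base : ∀ {a} → Filter Member a → ∃ λ k → meets e k ≤ a
    base (generator {a} a∈T) = suc (to (a , a∈T)) , ≤-trans (x∧y≤y _ _) (nth-to (a , a∈T) em)
    base top                 = 0 , ≤-refl
    base (meet p q) with k , k≤a ← base p | l , l≤b ← base q =
      k ℕ.⊔ l , ∧-greatest (≤-trans (meets-⊔ˡ e k l) k≤a) (≤-trans (meets-⊔ʳ e k l) l≤b)
    base (up a≤b p) with k , k≤a ← base p = k , ≤-trans k≤a a≤b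

  -- Lindenbaum's construction along the well-order γ: x is accepted when it
  -- is consistent with the accepted elements before it.
  module Lindenbaum (0≉1 : 0# ≉ 1#) (γ : Ordinal) (ι : A-setoid ≲ Ordinal.underlying γ) where

    open Ordinal (onInjection γ {A-setoid} ι) using (_<_; wellFounded; strictTotalOrder)
    open StrictTotalOrder strictTotalOrder using (compare; <-respʳ-≈) renaming (trans to <-trans)

    Accepted′ : ∀ x → Acc _<_ x → Set
    Accepted′ x (acc rs) = ¬ Filter (λ y → (Σ[ y<x ∈ y < x ] Accepted′ y (rs y<x)) ⊎ y ≡ x) 0#

    -- By recursion, generators accepted under one accessibility proof are accepted under the other,
    -- so consistency carries over.
    Accepted′-irr : ∀ {x} p q → Accepted′ x p → Accepted′ x q
    Accepted′-irr (acc rs) (acc rs′) consistent bad = consistent (Filter-bind earlier bad)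
      where
      earlier : ∀ {y} → _ → Filter _ y
      earlier (inj₁ (y<x , y-acc)) = generator (inj₁ (y<x , Accepted′-irr (rs′ y<x) (rs y<x) y-acc))
      earlier (inj₂ refl)          = generator (inj₂ refl)

    Accepted : Pred Carrier 0ℓ
    Accepted x = Accepted′ x (wellFounded x)

    Stage : Carrier → Pred Carrier 0ℓ
    Stage x y = (y < x × Accepted y) ⊎ y ≡ x

    accepted⇒consistent : ∀ {x} → Accepted x → ¬ Filter (Stage x) 0#
    accepted⇒consistent {x} = go (wellFounded x)
      where
      go : ∀ p → Accepted′ x p → ¬ Filter (Stage x) 0#
      go (acc rs) consistent bad = consistent (Filter-bind earlier bad)
        where
        earlier : ∀ {y} → Stage x y → Filter _ y
        earlier (inj₁ (y<x , y-acc)) = generator (inj₁ (y<x , Accepted′-irr (wellFounded _) (rs y<x) y-acc))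
        earlier (inj₂ refl)          = generator (inj₂ refl)

    consistent⇒accepted : ∀ {x} → ¬ Filter (Stage x) 0# → Accepted x
    consistent⇒accepted {x} consistent = go (wellFounded x)
      where
      go : ∀ p → Accepted′ x p
      go (acc rs) bad = consistent (Filter-bind earlier bad)
        where
        earlier : ∀ {y} → _ → Filter (Stage x) y
        earlier (inj₁ (y<x , y-acc)) = generator (inj₁ (y<x , Accepted′-irr (rs y<x) (wellFounded _) y-acc))
        earlier (inj₂ refl)          = generator (inj₂ refl)

    Stage-mono : ∀ {x z} → Accepted x → x < z → Filter (Stage x) ⊆ Filter (Stage z)
    Stage-mono x-acc x<z = Filter-bind λ where
      (inj₁ (y<x , y-acc)) → generator (inj₁ (<-trans y<x x<z , y-acc))
      (inj₂ refl)          → generator (inj₁ (x<z , x-acc))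

    Stage-resp : ∀ {x z} → x ≈ z → Filter (Stage x) ⊆ Filter (Stage z)
    Stage-resp x≈z = Filter-bind λ where
      (inj₁ (y<x , y-acc)) → generator (inj₁ (<-respʳ-≈ x≈z y<x , y-acc))
      (inj₂ refl)          → up (≤-reflexive (≈-sym x≈z)) (generator (inj₂ refl))

    -- A derivation involves finitely many accepted elements, and the stage of the latest one
    -- contains them all. The alternative `1# ≤ a` covers derivations without generators.
    bounded : ∀ {a} → Filter Accepted a → 1# ≤ a ⊎ ∃ λ x → Accepted x × Filter (Stage x) a
    bounded (generator x-acc) = inj₂ (_ , x-acc , generator (inj₂ refl))
    bounded top               = inj₁ ≤-refl
    bounded (up a≤b p) with bounded p
    ... | inj₁ 1≤a           = inj₁ (≤-trans 1≤a a≤b)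
    ... | inj₂ (x , x-acc , q) = inj₂ (x , x-acc , up a≤b q)
    bounded (meet p q) with bounded p | bounded q
    ... | inj₁ 1≤a | inj₁ 1≤b = inj₁ (∧-greatest 1≤a 1≤b)
    ... | inj₁ 1≤a | inj₂ (x , x-acc , r) = inj₂ (x , x-acc , meet (up 1≤a top) r)
    ... | inj₂ (x , x-acc , r) | inj₁ 1≤b = inj₂ (x , x-acc , meet r (up 1≤b top))
    ... | inj₂ (x , x-acc , r) | inj₂ (z , z-acc , s) with compare x z
    ...   | tri< x<z _ _ = inj₂ (z , z-acc , meet (Stage-mono x-acc x<z r) s)
    ...   | tri≈ _ x≈z _ = inj₂ (z , z-acc , meet (Stage-resp x≈z r) s)
    ...   | tri> _ _ z<x = inj₂ (x , x-acc , meet r (Stage-mono z-acc z<x s))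

    proper : ¬ Filter Accepted 0#
    proper bad with bounded bad
    ... | inj₁ 1≤0             = 0≉1 (≈-sym (≤0⇒≈0 1≤0))
    ... | inj₂ (x , x-acc , q) = accepted⇒consistent x-acc q

    U : Subset A
    U = record
      { Member = Filter Accepted
      ; resp   = λ x≈y → up (≤-reflexive x≈y)
      }

    -- The generating set `U` is itself a filter, hence the doubled `Filter`. A proper filter `V`
    -- that extends it and has `a` as a member contains `Stage a`, so `Stage a` is consistent and
    -- `a` is accepted.
    ultrafilter : IsUltrafilter A (Filter (Filter Accepted))
    ultrafilter =
        record { has-1 = top ; ∧-clos = meet ; ↑-clos = up ; proper = proper ∘ Filter-bind id }
      , λ V V-filter U⊆V {a} a∈V → generator (generator (consistent⇒accepted λ bad →
          IsProperFilter.proper V-filter (Filter-least V-filter (λ where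
            (inj₁ (_ , y-acc)) → U⊆V (generator (generator y-acc))
            (inj₂ refl)        → a∈V) bad)))

  -- The embedding into `γ` bounds `U` from above. Uncountability of generating sets then gives `U`
  -- size `ω₁` and embeds `γ` into every competitor.
  isU-ω₁ : EM → AxiomOfChoice → Splitting → 0# ≉ 1# →
           (γ : Ordinal) → IsOmega₁ γ → A-setoid ≲ Ordinal.underlying γ → IsU A ω₁
  isU-ω₁ em ac splitting 0≉1 γ γ-ω₁ ι =
      U
    , (ultrafilter , ultrafilter-nonprincipal splitting ultrafilter)
    , ≲ω₁-uncountable⇒ω₁ γ γ-ω₁ U≲γ (generators-uncountable em splitting U ultrafilter)
    , λ T (T-ultra , _) → Compose.injection U≲γ
        (¬Countable⇒ω₁≲ em ac γ γ-ω₁ {Subset.asSetoid T} (generators-uncountable em splitting T T-ultra))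
    where
    open Lindenbaum 0≉1 γ ι
    open Injection ι
    U≲γ : Subset.asSetoid U ≲ Ordinal.underlying γ
    U≲γ = record { to = to ∘ proj₁ ; cong = cong ; injective = injective }

  -- The maximal ideal-independent family and the maximal free sequence of a disjoint family.

  module Cascade
    (em : EM) (ac : AxiomOfChoice) (y : ℕ → Carrier)
    (y≉0 : ∀ n → y n ≉ 0#)
    (disjoint : ∀ {m n} → m ≢ n → y m ≤ - y n)
    (dichotomy : ∀ a → Ideal (λ b → ∃ λ n → b ≈ y n) a ⊎ ∃ λ n → y n ≤ a)
    where

    Range : Pred Carrier 0ℓ
    Range b = ∃ λ n → b ≈ y n

    y-injective : ∀ {m n} → y m ≈ y n → m ≡ n
    y-injective {m} {n} ym≈yn = decidable-stable (m ℕ.≟ n) λ m≢n →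
      y≉0 m (≤-∧- (≤-reflexive ym≈yn) (disjoint m≢n))

    Y : Subset A
    Y = record { Member = Range ; resp = λ a≈b (n , a≈yn) → n , ≈-trans (≈-sym a≈b) a≈yn }

    Y↔ℕ : Inverse (Subset.asSetoid Y) (setoid ℕ)
    Y↔ℕ = record
      { to        = λ (_ , n , _) → n
      ; from      = λ n → y n , n , ≈-refl
      ; to-cong   = λ {(_ , _ , a≈ym)} {(_ , _ , b≈yn)} a≈b →
                      y-injective (≈-trans (≈-sym a≈ym) (≈-trans a≈b b≈yn))
      ; from-cong = λ m≡n → ≈-reflexive (≡.cong y m≡n)
      ; inverse   = (λ {n} {(_ , m , b≈ym)} b≈yn → y-injective (≈-trans (≈-sym b≈ym) b≈yn))
                  , (λ {(_ , _ , a≈ym)} n≡m → ≈-trans (≈-reflexive (≡.cong y n≡m)) (≈-sym a≈ym))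
      }

    -- By disjointness `- y n` bounds all other members, hence the ideal they generate, while the
    -- nonzero `y n` is not below it.
    Y-independent : IdealIndependent A Y
    Y-independent a (n , a≈yn) a∈ideal = y≉0 n (≤-∧- ≤-refl (≤-respˡ-≈ a≈yn (below a∈ideal)))
      where
      below : ∀ {b} → Ideal (λ c → Range c × c ≉ a) b → b ≤ - y n
      below (generator ((m , b≈ym) , b≉a)) = ≤-respˡ-≈ (≈-sym b≈ym)
        (disjoint λ m≡n → b≉a (≈-trans b≈ym (≈-trans (≈-reflexive (≡.cong y m≡n)) (≈-sym a≈yn))))
      below bottom       = 0≤ _
      below (join p q)   = ∨-least (below p) (below q)
      below (down a≤b p) = ≤-trans a≤b (below p)

    Ideal-mono : ∀ {S T : Pred Carrier 0ℓ} → S ⊆ T → Ideal S ⊆ Ideal T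
    Ideal-mono S⊆T (generator s) = generator (S⊆T s)
    Ideal-mono S⊆T bottom        = bottom
    Ideal-mono S⊆T (join p q)    = join (Ideal-mono S⊆T p) (Ideal-mono S⊆T q)
    Ideal-mono S⊆T (down a≤b p)  = down a≤b (Ideal-mono S⊆T p)

    -- For a new `a` in `Z`, either `a` lies in the ideal of the old members or some `y n` lies
    -- below `a`; each contradicts the independence of `Z`.
    Y-maximal : MaximalIdealIndependent A Y
    Y-maximal = Y-independent , λ Z Z-independent Y⊆Z {a} a∈Z →
      decidable-stable em λ a∉Y → absurd Z Z-independent Y⊆Z a∈Z a∉Y (dichotomy a)
      where
      absurd : ∀ Z → IdealIndependent A Z → Range ⊆ Subset.Member Z → ∀ {a} → Subset.Member Z a →
               ¬ Range a → ¬ (Ideal Range a ⊎ ∃ λ n → y n ≤ a)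
      absurd Z Z-independent Y⊆Z {a} a∈Z a∉Y (inj₁ a∈ideal) = Z-independent a a∈Z
        (Ideal-mono (λ b∈Y → Y⊆Z b∈Y , λ b≈a → a∉Y (Subset.resp Y b≈a b∈Y)) a∈ideal)
      absurd Z Z-independent Y⊆Z {a} a∈Z a∉Y (inj₂ (n , yn≤a)) = Z-independent (y n) (Y⊆Z (n , ≈-refl))
        (down yn≤a (generator (a∈Z , λ a≈yn → a∉Y (n , a≈yn))))

    -- Minimality is immediate, since every competitor is infinite.
    isSmm-ω : IsSmm A ω
    isSmm-ω = Y , (ℕ-infinite ∘ Finite-resp-↔ Y↔ℕ , Y-maximal) , Y↔ℕ ,
      λ Z (Z-infinite , _) →
        Compose.injection (Inverse⇒Injection Y↔ℕ) (¬Finite⇒ℕ≲ em ac {Subset.asSetoid Z} Z-infinite)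

    joins : ℕ → Carrier
    joins zero    = 0#
    joins (suc n) = joins n ∨ y n

    joins-mono : ∀ {m n} → m ℕ.≤′ n → joins m ≤ joins n
    joins-mono ℕ.≤′-refl       = ≤-refl
    joins-mono (ℕ.≤′-step m≤n) = ≤-trans (joins-mono m≤n) (x≤x∨y _ _)

    y≤joins : ∀ {m n} → m ℕ.< n → y m ≤ joins n
    y≤joins m<n = ≤-trans (y≤x∨y _ _) (joins-mono (ℕ.≤⇒≤′ m<n))

    y≤-joins : ∀ {m n} → n ℕ.≤ m → y m ≤ - joins n
    y≤-joins n≤m = ≤-⇒≤- (below n≤m)
      where
      below : ∀ {m n} → n ℕ.≤ m → joins n ≤ - y m
      below {n = zero}  _   = 0≤ _
      below {n = suc n} n<m = ∨-least (below (ℕ.<⇒≤ n<m)) (disjoint (ℕ.<⇒≢ n<m))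

    Ideal-bound : ∀ {a} → Ideal Range a → ∃ λ n → a ≤ joins n
    Ideal-bound (generator (n , a≈yn)) = suc n , ≤-trans (≤-reflexive a≈yn) (y≤joins ℕ.≤-refl)
    Ideal-bound bottom = 0 , ≤-refl
    Ideal-bound (join p q) with m , a≤ ← Ideal-bound p | n , b≤ ← Ideal-bound q =
      m ℕ.⊔ n , ∨-least (≤-trans a≤ (joins-mono (ℕ.≤⇒≤′ (ℕ.m≤m⊔n m n))))
                        (≤-trans b≤ (joins-mono (ℕ.≤⇒≤′ (ℕ.m≤n⊔m m n))))
    Ideal-bound (down a≤b p) with n , b≤ ← Ideal-bound p = n , ≤-trans a≤b b≤

    X : FreeSequence A
    X = record
      { length = ωₒ
      ; terms  = record
        { to   = λ n → - joins (suc n)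
        ; cong = λ m≡n → ≈-reflexive (≡.cong (λ n → - joins (suc n)) m≡n)
        }
      -- The product lies above `y (bound F)`, where `bound F` is the least strict upper bound of
      -- `F`, or `0` for empty `F`; all indices in `G` are at least `bound F`.
      ; free   = λ F G F<G → ≤-≉0
          (∧-greatest (∏-greatest (Allₚ.map⁺ (All.map y≤-joins (least-upper F))))
                      (∏-greatest (Allₚ.map⁺ (All.tabulate λ β∈G → ≤--joins
                        (above F (All.map (λ α<G → All.lookup α<G β∈G) F<G))))))
          (y≉0 (bound F))
      }
      where
      ≤--joins : ∀ {m n} → m ℕ.≤ n → y m ≤ - - joins (suc n)
      ≤--joins m≤n = ≤-trans (y≤joins (ℕ.s≤s m≤n)) (≤-reflexive (≈-sym (¬-involutive _)))
      bound : List ℕ → ℕ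
      bound []      = 0
      bound (α ∷ F) = suc α ℕ.⊔ bound F
      least-upper : ∀ F → All (ℕ._< bound F) F
      least-upper []      = []
      least-upper (α ∷ F) = ℕ.m≤m⊔n (suc α) (bound F)
                          ∷ All.map (λ p → ℕ.≤-trans p (ℕ.m≤n⊔m (suc α) (bound F))) (least-upper F)
      above : ∀ F {β} → All (ℕ._< β) F → bound F ℕ.≤ β
      above []      []       = ℕ.z≤n
      above (α ∷ F) (p ∷ ps) = ℕ.⊔-lub p (above F ps)

    -- Suppose `β` lies beyond every `embed n`. If `term β` is in the ideal, it is below some
    -- `joins n` and hence disjoint from the term at `n`. If `y n` is below `term β`, the terms just
    -- before and at `n` differ by `y n`, which has no part outside `term β`. Either way freeness
    -- fails.
    X-maximal : MaximalFreeSequence A X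
    X-maximal Z Z-ext β = decidable-stable em λ β∉ → absurd β∉ (dichotomy (term β))
      where
      open FreeSequence Z using (term; free; length)
      open _EndExtends_ Z-ext
      open StrictTotalOrder (Ordinal.strictTotalOrder length) using (_<_; compare) renaming (_≈_ to _≈ᵢ_)

      before : ¬ (∃ λ n → embed n ≈ᵢ β) → ∀ n → embed n < β
      before β∉ n with compare (embed n) β
      ... | tri< p _ _ = p
      ... | tri≈ _ p _ = contradiction (n , p) β∉
      -- A `β` preceding `embed n` would itself be a value of `embed`.
      ... | tri> _ _ p = contradiction (initialSegment p) β∉

      term-embed : ∀ n → term (embed n) ≤ - joins (suc n)
      term-embed n = ≤-reflexive (agrees n)

      initial : ¬ (∃ λ n → embed n ≈ᵢ β) → ∀ n →
        ∃ λ F → All (λ α → All (α <_) (embed n ∷ β ∷ [])) F × ∏ A (map term F) ≤ - joins n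
      -- No term precedes index `0`, but `joins 0` is `0#`, so the empty product suffices.
      initial β∉ zero    = [] , [] , ≤-⇒≤- (0≤ _)
      initial β∉ (suc n) = embed n ∷ []
                         , (monotone ℕ.≤-refl ∷ before β∉ n ∷ []) ∷ []
                         , ≤-trans (x∧y≤x _ _) (term-embed n)

      absurd : ¬ (∃ λ n → embed n ≈ᵢ β) → ¬ (Ideal Range (term β) ⊎ ∃ λ n → y n ≤ term β)
      absurd β∉ (inj₁ z∈ideal) with n , z≤joins ← Ideal-bound z∈ideal =
        free (embed n ∷ β ∷ []) [] ([] ∷ [] ∷ [])
          (≤-∧- (≤-trans (x∧y≤x _ _) (≤-trans (x∧y≤y _ _) (≤-trans (x∧y≤x _ _) (≤-trans z≤joins (x≤x∨y _ _)))))
                (≤-trans (x∧y≤x _ _) (≤-trans (x∧y≤x _ _) (term-embed n))))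
      absurd β∉ (inj₂ (n , yn≤z)) with F , F<G , ∏F≤ ← initial β∉ n =
        free F (embed n ∷ β ∷ []) F<G
          (≤-∧- (≤-trans p≤yn yn≤z) (≤-trans (x∧y≤y _ _) (≤-trans (x∧y≤y _ _) (x∧y≤x _ _))))
        where
        -- By distributivity, the part of `joins n ∨ y n` inside `- joins n` lies in `y n`.
        p≤yn : ∏ A (map term F) ∧ ∏ A (map (λ α → - term α) (embed n ∷ β ∷ [])) ≤ y n
        p≤yn = ≤-trans
          (∧-greatest (≤-trans (x∧y≤x _ _) ∏F≤)
             (≤-trans (x∧y≤y _ _) (≤-trans (x∧y≤x _ _)
               (≤-trans (≤-reflexive (¬-cong (agrees n))) (≤-reflexive (¬-involutive _))))))
          (≤-trans (≤-reflexive (∧-distribˡ-∨ _ _ _))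
             (∨-least (≤-trans (≤-reflexive (≈-trans (∧-comm _ _) (∧-complementʳ _))) (0≤ _)) (x∧y≤y _ _)))

  -- Extending finite free sequences.

  module _ (splitting : Splitting) (x : FreeSequence A) where
    open FreeSequence x
    private
      module length = StrictTotalOrder (Ordinal.strictTotalOrder length)
    open length using (_<_) renaming (_≈_ to _≈ᵢ_)
    open StrictSupremum _<_
    open PointEquality _≈ᵢ_ using (_≈∙_; ∙≈∙) renaming ([_] to [_]≈)

    -- A new last term w must satisfy 0 < w < ∏ x; every product over
    -- F < G then stays above one of w, ∏ x - w, or an old product.
    finite⇒not-maximal : Finite (Ordinal.underlying length) → ¬ MaximalFreeSequence A x
    finite⇒not-maximal (xs , enum) maximal = not-old (maximal extension extends ⊤⁺)
      where
      p w : Carrier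
      p = ∏ A (map term xs)
      c : ∃ λ c → p ∧ c ≉ 0# × p ∧ - c ≉ 0#
      -- Freeness with empty `G` makes `p` nonzero.
      c = split splitting λ p≈0 → free xs [] (All.universal (λ _ → []) xs)
            (≤0⇒≈0 (≤-trans (x∧y≤x _ _) (≤-reflexive p≈0)))
      w = p ∧ proj₁ c

      p≤term : ∀ α → p ≤ term α
      p≤term α with q , α≈q ← All.lookupAny (Allₚ.map⁻ (∏-lower (map term xs))) (enum α) =
        ≤-trans q (≤-reflexive (Func.cong terms (length.Eq.sym α≈q)))

      w≤term : ∀ α → w ≤ term α
      w≤term α = ≤-trans (x∧y≤x _ _) (p≤term α)

      term⁺ : length.Carrier ⁺ → Carrier
      term⁺ ⊤⁺    = w
      term⁺ [ α ] = term α

      w≤term⁺ : ∀ α → w ≤ term⁺ α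
      w≤term⁺ ⊤⁺    = ≤-refl
      w≤term⁺ [ α ] = w≤term α

      old : List (length.Carrier ⁺) → List length.Carrier
      old []            = []
      old (⊤⁺ ∷ αs)     = old αs
      old ([ α ] ∷ αs)  = α ∷ old αs

      All-old : ∀ {P : Pred (length.Carrier ⁺) 0ℓ} αs → All P αs → All (P ∘ [_]) (old αs)
      All-old []           []       = []
      All-old (⊤⁺ ∷ αs)    (_ ∷ ps) = All-old αs ps
      All-old ([ α ] ∷ αs) (p ∷ ps) = p ∷ All-old αs ps

      -- `⊤⁺` is the greatest index and precedes no `β`, so it cannot occur in `F`.
      positive : ∀ {d β} F → All (_<⁺ β) F → All (d ≤_) (map term (old F)) → All (d ≤_) (map term⁺ F)
      positive []          []             []       = []
      positive ([ α ] ∷ F) (_ ∷ F<β)      (q ∷ qs) = q ∷ positive F F<β qs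
      positive (⊤⁺ ∷ F)    (() ∷ _)

      negative : ∀ {d} G → d ≤ - w → All (d ≤_) (map (λ β → - term β) (old G)) →
                 All (d ≤_) (map (λ β → - term⁺ β) G)
      negative []          d≤-w []       = []
      negative ([ β ] ∷ G) d≤-w (q ∷ qs) = q ∷ negative G d≤-w qs
      negative (⊤⁺ ∷ G)    d≤-w qs       = d≤-w ∷ negative G d≤-w qs

      free⁺ : ∀ F G → All (λ α → All (α <⁺_) G) F →
              ∏ A (map term⁺ F) ∧ ∏ A (map (λ β → - term⁺ β) G) ≉ 0#
      free⁺ F [] _ = ≤-≉0 (∧-greatest (∏-greatest (Allₚ.map⁺ (All.universal w≤term⁺ F))) (≤1 _))
                          (proj₁ (proj₂ c))
      free⁺ F G@(β ∷ _) F<G = case-old (old G) refl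
        where
        F<β : All (_<⁺ β) F
        F<β = All.map All.head F<G
        case-old : ∀ G′ → old G ≡ G′ → ∏ A (map term⁺ F) ∧ ∏ A (map (λ β → - term⁺ β) G) ≉ 0#
        -- Here `G` has only the new index, and the part of `p` outside the splitting element lies
        -- below every factor.
        case-old [] eq = ≤-≉0
          (∧-greatest
            (∏-greatest (positive F F<β (Allₚ.map⁺ (All.universal (λ α → ≤-trans (x∧y≤x _ _) (p≤term α)) (old F)))))
            (∏-greatest (negative G (≤-trans (x∧y≤y _ _) (-‿antitone (x∧y≤y _ _)))
              (≡.subst (λ G′ → All _ (map _ G′)) (≡.sym eq) []))))
          (proj₂ (proj₂ c))
        -- An old `γ` in `G` has `w ≤ term γ`, so its factor `- term γ` already puts the old product
        -- below `- w`.
        case-old (γ ∷ G′) eq = ≤-≉0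
          (∧-greatest
            (∏-greatest (positive F F<β (All.map (≤-trans (x∧y≤x _ _)) (∏-lower _))))
            (∏-greatest (negative G d≤-w
              (≡.subst (λ G′ → All _ (map _ G′)) (≡.sym eq) (All.map (≤-trans (x∧y≤y _ _)) (∏-lower _))))))
          (free (old F) (γ ∷ G′) (≡.subst (λ G′ → All (λ α → All (α <_) G′) (old F)) eq
            (All.map (λ q → All.map [<]-injective (All-old G q)) (All-old F F<G))))
          where
          d≤-w : ∏ A (map term (old F)) ∧ ∏ A (map (λ β → - term β) (γ ∷ G′)) ≤ - w
          d≤-w = ≤-trans (x∧y≤y _ _) (≤-trans (x∧y≤x _ _) (-‿antitone (w≤term γ)))

      acc-[_] : ∀ {α} → Acc _<_ α → Acc _<⁺_ [ α ]
      acc-[ acc rs ] = acc λ { [ β<α ] → acc-[ rs β<α ] }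

      extension : FreeSequence A
      extension = record
        { length = record
          { strictTotalOrder = record { isStrictTotalOrder = <⁺-isStrictTotalOrder length.isStrictTotalOrder }
          ; wellFounded = λ where
              [ α ] → acc-[ Ordinal.wellFounded length α ]
              ⊤⁺    → acc λ { [ β ]<⊤⁺ → acc-[ Ordinal.wellFounded length β ] }
          }
        ; terms = record
          { to = term⁺
          ; cong = λ { ∙≈∙ → ≈-refl ; [ α≈β ]≈ → Func.cong terms α≈β }
          }
        ; free = free⁺
        }

      extends : _EndExtends_ A extension x
      extends = record
        { embedding      = record { to = [_] ; cong = [_]≈ }
        ; monotone       = [_]
        ; initialSegment = λ { {β = [ β ]} _ → β , [ length.Eq.refl ]≈ }
        ; agrees         = λ _ → ≈-refl
        }

      not-old : ¬ ∃ λ α → [ α ] ≈∙ ⊤⁺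
      not-old (_ , ())

  isF-ω : EM → AxiomOfChoice → Splitting → (x : FreeSequence A) → MaximalFreeSequence A x →
          ω (Ordinal.underlying (FreeSequence.length x)) → IsF A ω
  isF-ω em ac splitting x x-maximal x↔ℕ = x , x-maximal , x↔ℕ , λ z z-maximal →
    Compose.injection (Inverse⇒Injection x↔ℕ)
      (¬Finite⇒ℕ≲ em ac {Ordinal.underlying (FreeSequence.length z)}
        λ fin → finite⇒not-maximal splitting z fin z-maximal)

-- Infinite sets of natural numbers.

open import Data.Bool.Base using (Bool; true; false; _∧_; _∨_; not)

Unbounded : Pred ℕ 0ℓ → Set
Unbounded P = ∀ M → ∃ λ m → M ℕ.≤ m × P m

¬Unbounded⇒eventually¬ : EM → {P : Pred ℕ 0ℓ} → ¬ Unbounded P → ∃ λ M → ∀ {m} → M ℕ.≤ m → ¬ P m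
¬Unbounded⇒eventually¬ em ¬unb with M , ¬∃ ← ¬∀⇒∃¬ em ¬unb = M , λ M≤m Pm → ¬∃ (_ , M≤m , Pm)

antitone : (V : ℕ → Pred ℕ 0ℓ) → (∀ k → V (suc k) ⊆ V k) → ∀ {k l} → k ℕ.≤′ l → V l ⊆ V k
antitone V V-step ℕ.≤′-refl       Vm = Vm
antitone V V-step (ℕ.≤′-step k≤l) Vm = antitone V V-step k≤l (V-step _ Vm)

-- D consists of every other member of a strictly increasing sequence s
-- with s j ∈ V j.
split-unbounded : EM → (V : ℕ → Pred ℕ 0ℓ) → (∀ k → V (suc k) ⊆ V k) → (∀ k → Unbounded (V k)) →
  ∃ λ (D : ℕ → Bool) → ∀ k → Unbounded (λ m → V k m × D m ≡ true) × Unbounded (λ m → V k m × D m ≡ false)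
split-unbounded em V V-step unb = D , λ k →
    -- With `j = k + M` the index `2 * j` is at least `k`, which gives membership in `V k`, and at
    -- least `M`, which makes the witness large enough.
    (λ M → let j = k ℕ.+ M in s (2 ℕ.* j)
         , ℕ.≤-trans (ℕ.m≤n+m M k) (ℕ.≤-trans (ℕ.m≤n*m j 2) (j≤sj _))
         , V-decreasing (ℕ.≤-trans (ℕ.m≤m+n k M) (ℕ.m≤n*m j 2)) (s∈V _)
         , D-even j em)
  , (λ M → let j = k ℕ.+ M in s (suc (2 ℕ.* j))
         , ℕ.≤-trans (ℕ.m≤n+m M k) (ℕ.≤-trans (ℕ.m≤n*m j 2) (ℕ.≤-trans (ℕ.n≤1+n _) (j≤sj _)))
         , V-decreasing (ℕ.≤-trans (ℕ.m≤m+n k M) (ℕ.≤-trans (ℕ.m≤n*m j 2) (ℕ.n≤1+n _))) (s∈V _)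
         , D-odd j em)
  where
  s : ℕ → ℕ
  s zero    = proj₁ (unb 0 0)
  s (suc j) = proj₁ (unb (suc j) (suc (s j)))

  s∈V : ∀ j → V j (s j)
  s∈V zero    = proj₂ (proj₂ (unb 0 0))
  s∈V (suc j) = proj₂ (proj₂ (unb (suc j) (suc (s j))))

  s-step : ∀ j → s j ℕ.< s (suc j)
  s-step j = proj₁ (proj₂ (unb (suc j) (suc (s j))))

  s-mono : ∀ {i j} → suc i ℕ.≤′ j → s i ℕ.< s j
  s-mono ℕ.≤′-refl       = s-step _
  s-mono (ℕ.≤′-step i<j) = ℕ.<-trans (s-mono i<j) (s-step _)

  j≤sj : ∀ j → j ℕ.≤ s j
  j≤sj zero    = ℕ.z≤n
  j≤sj (suc j) = ℕ.≤-<-trans (j≤sj j) (s-step j)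

  s-injective : ∀ {i j} → s i ≡ s j → i ≡ j
  s-injective {i} {j} eq with ℕ.<-cmp i j
  ... | tri< i<j _ _ = contradiction eq (ℕ.<⇒≢ (s-mono (ℕ.≤⇒≤′ i<j)))
  ... | tri≈ _ i≡j _ = i≡j
  ... | tri> _ _ j<i = contradiction (≡.sym eq) (ℕ.<⇒≢ (s-mono (ℕ.≤⇒≤′ j<i)))

  V-decreasing : ∀ {k l} → k ℕ.≤ l → V l ⊆ V k
  V-decreasing k≤l = antitone V V-step (ℕ.≤⇒≤′ k≤l)

  D : ℕ → Bool
  D m = does (em {P = ∃ λ j → s (2 ℕ.* j) ≡ m})

  D-even : ∀ j (d : Dec (∃ λ i → s (2 ℕ.* i) ≡ s (2 ℕ.* j))) → does d ≡ true
  D-even j (yes _) = refl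
  D-even j (no ¬∃) = contradiction (j , refl) ¬∃

  D-odd : ∀ j (d : Dec (∃ λ i → s (2 ℕ.* i) ≡ s (suc (2 ℕ.* j)))) → does d ≡ false
  D-odd j (yes (i , eq)) = contradiction (s-injective eq) (ℕ.even≢odd i j)
  D-odd j (no _)         = refl

-- The Boolean algebra.

-- The algebra of those (aₙ) in the power ∏ₙ P(ω)/fin for which almost all
-- aₙ are 0 or 1.  The row entry n represents aₙ modulo finite; for n ≥ bound
-- the representative of 0 or 1 is chosen constant.
record Element : Set where
  field
    entry    : ℕ → ℕ → Bool
    bound    : ℕ
    constant : ∀ {n} m → bound ℕ.≤ n → entry n m ≡ entry n 0

open Element

infix 4 _≈ₑ_

-- Each row has its own threshold `M`, with no uniformity in `n`: this is equality in a power of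
-- P(ω)/fin.
record _≈ₑ_ (a b : Element) : Set where
  constructor mod-finite
  field
    rows : ∀ n → ∃ λ M → ∀ {m} → M ℕ.≤ m → entry a n m ≡ entry b n m

open _≈ₑ_

pointwise : ∀ {a b} → (∀ n m → entry a n m ≡ entry b n m) → a ≈ₑ b
pointwise eq = mod-finite λ n → 0 , λ _ → eq n _

row-constant : (ℕ → Bool) → Element
row-constant D = record { entry = λ n _ → D n ; bound = 0 ; constant = λ _ _ → refl }

lift₁ : (Bool → Bool) → Element → Element
lift₁ f a = record
  { entry    = λ n m → f (entry a n m)
  ; bound    = bound a
  ; constant = λ m b≤n → ≡.cong f (constant a m b≤n)
  }

lift₂ : (Bool → Bool → Bool) → Element → Element → Element
lift₂ _∙_ a b = record
  { entry    = λ n m → entry a n m ∙ entry b n m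
  ; bound    = bound a ℕ.⊔ bound b
  ; constant = λ m b≤n → ≡.cong₂ _∙_ (constant a m (ℕ.m⊔n≤o⇒m≤o _ _ b≤n)) (constant b m (ℕ.m⊔n≤o⇒n≤o _ _ b≤n))
  }

lift₂-cong : ∀ f {a b c d} → a ≈ₑ b → c ≈ₑ d → lift₂ f a c ≈ₑ lift₂ f b d
lift₂-cong f (mod-finite a≈b) (mod-finite c≈d) = mod-finite λ n →
  let (M , p) = a≈b n
      (N , q) = c≈d n
  in M ℕ.⊔ N , λ M⊔N≤m → ≡.cong₂ f (p (ℕ.m⊔n≤o⇒m≤o _ _ M⊔N≤m)) (q (ℕ.m⊔n≤o⇒n≤o _ _ M⊔N≤m))

𝔸 : BooleanAlgebra 0ℓ 0ℓ
𝔸 = record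
  { Carrier = Element
  ; _≈_ = _≈ₑ_
  ; _∨_ = lift₂ _∨_
  ; _∧_ = lift₂ _∧_
  ; ¬_  = lift₁ not
  ; ⊤   = row-constant λ _ → true
  ; ⊥   = row-constant λ _ → false
  ; isBooleanAlgebra = record
    { isDistributiveLattice = record
      { isLattice = record
        { isEquivalence = record
          { refl  = pointwise λ _ _ → refl
          ; sym   = λ (mod-finite p) → mod-finite λ n → proj₁ (p n) , ≡.sym ∘ proj₂ (p n)
          ; trans = λ (mod-finite p) (mod-finite q) → mod-finite λ n →
              proj₁ (p n) ℕ.⊔ proj₁ (q n) , λ M≤m →
                ≡.trans (proj₂ (p n) (ℕ.m⊔n≤o⇒m≤o _ _ M≤m)) (proj₂ (q n) (ℕ.m⊔n≤o⇒n≤o _ _ M≤m))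
          }
        ; ∨-comm     = λ a b → pointwise λ n m → Bool.∨-comm (entry a n m) (entry b n m)
        ; ∨-assoc    = λ a b c → pointwise λ n m → Bool.∨-assoc (entry a n m) (entry b n m) (entry c n m)
        ; ∨-cong     = lift₂-cong _∨_
        ; ∧-comm     = λ a b → pointwise λ n m → Bool.∧-comm (entry a n m) (entry b n m)
        ; ∧-assoc    = λ a b c → pointwise λ n m → Bool.∧-assoc (entry a n m) (entry b n m) (entry c n m)
        ; ∧-cong     = lift₂-cong _∧_
        ; absorptive = (λ a b → pointwise λ n m → Bool.∨-abs-∧ (entry a n m) (entry b n m))
                     , (λ a b → pointwise λ n m → Bool.∧-abs-∨ (entry a n m) (entry b n m))
        }
      ; ∨-distrib-∧ = (λ a b c → pointwise λ n m → Bool.∨-distribˡ-∧ (entry a n m) (entry b n m) (entry c n m))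
                    , (λ a b c → pointwise λ n m → Bool.∨-distribʳ-∧ (entry a n m) (entry b n m) (entry c n m))
      ; ∧-distrib-∨ = (λ a b c → pointwise λ n m → Bool.∧-distribˡ-∨ (entry a n m) (entry b n m) (entry c n m))
                    , (λ a b c → pointwise λ n m → Bool.∧-distribʳ-∨ (entry a n m) (entry b n m) (entry c n m))
      }
    ; ∨-complement = (λ a → pointwise λ n m → Bool.∨-inverseˡ (entry a n m))
                   , (λ a → pointwise λ n m → Bool.∨-inverseʳ (entry a n m))
    ; ∧-complement = (λ a → pointwise λ n m → Bool.∧-inverseˡ (entry a n m))
                   , (λ a → pointwise λ n m → Bool.∧-inverseʳ (entry a n m))
    ; ¬-cong = λ (mod-finite p) → mod-finite λ n → proj₁ (p n) , ≡.cong not ∘ proj₂ (p n)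
    }
  }

open BooleanFacts 𝔸 using
  ( 0#; 1#; -_; _≈_; _≉_; _≤_; A-setoid; ≈-sym; ≈-trans; meets; Splitting; Ideal
  ; atomless; isU-ω₁; isF-ω; module Cascade )
  renaming (_∧_ to _⊓_; _∨_ to _⊔_)

Row : Element → ℕ → Pred ℕ 0ℓ
Row a n m = entry a n m ≡ true

unbounded-row⇒≉0 : ∀ {a} n → Unbounded (Row a n) → a ≉ 0#
unbounded-row⇒≉0 n unb (mod-finite a≈0) with M , eq ← a≈0 n with m , M≤m , am≡true ← unb M
  with () ← ≡.trans (≡.sym am≡true) (eq M≤m)

bounded-rows⇒≈0 : EM → ∀ {a} → (∀ n → ¬ Unbounded (Row a n)) → a ≈ 0#
bounded-rows⇒≈0 em ¬unb = mod-finite λ n →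
  let (M , p) = ¬Unbounded⇒eventually¬ em (¬unb n) in M , λ M≤m → Bool.¬-not (p M≤m)

pointwise-≤ : ∀ a b → (∀ n m → entry a n m ≡ true → entry b n m ≡ true) → a ≤ b
pointwise-≤ a b h = pointwise λ n m → lemma (entry a n m) (entry b n m) (h n m)
  where
  lemma : ∀ p q → (p ≡ true → q ≡ true) → p ≡ p ∧ q
  lemma false q h = refl
  lemma true  q h = ≡.sym (h refl)

-- The splitting property of `𝔸`.

module Splits (em : EM) (e : ℕ → Element) (meets≉0 : ∀ k → meets e k ≉ 0#) where

  u : ℕ → Element
  u = meets e

  u-step : ∀ k {n} → Row (u (suc k)) n ⊆ Row (u k) n
  u-step k {n} {m} = Bool.∧-conicalˡ (entry (u k) n m) (entry (e k) n m)

  u-antitone : ∀ {k l} n → k ℕ.≤ l → Row (u l) n ⊆ Row (u k) n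
  u-antitone n k≤l = antitone (λ k → Row (u k) n) (λ k → u-step k) (ℕ.≤⇒≤′ k≤l)

  -- The sets in row `n` are infinite and decreasing, so one `D` splits them all; `c` carries `D` in
  -- row `n` and zeros elsewhere.
  splits-row : ∀ n → (∀ k → Unbounded (Row (u k) n)) →
               ∃ λ c → ∀ k → u k ⊓ c ≉ 0# × u k ⊓ - c ≉ 0#
  splits-row n unb with D , D-splits ← split-unbounded em (λ k → Row (u k) n) (λ k → u-step k) unb = c D , λ k →
      unbounded-row⇒≉0 n (λ M → let (m , M≤m , um , Dm) = proj₁ (D-splits k) M in
        m , M≤m , ≡.cong₂ _∧_ um (c-row D Dm))
    , unbounded-row⇒≉0 n (λ M → let (m , M≤m , um , Dm) = proj₂ (D-splits k) M in
        m , M≤m , ≡.cong₂ (λ p q → p ∧ not q) um (c-row D Dm))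
    where
    c : (ℕ → Bool) → Element
    c D = record
      { entry    = λ n′ m → does (n′ ℕ.≟ n) ∧ D m
      -- Row `n` itself need not be constant, so constancy starts just after it.
      ; bound    = suc n
      ; constant = λ {n′} m n<n′ → ≡.trans (outside (n′ ℕ.≟ n) n<n′ (D m)) (≡.sym (outside (n′ ℕ.≟ n) n<n′ (D 0)))
      }
      where
      outside : ∀ {n′} (d : Dec (n′ ≡ n)) → n ℕ.< n′ → ∀ b → does d ∧ b ≡ false
      outside (yes refl) n<n _ = contradiction n<n (ℕ.<-irrefl refl)
      outside (no _)     _   _ = refl
    c-row : ∀ D {m b} → D m ≡ b → entry (c D) n m ≡ b
    c-row D {m} eq = ≡.trans (≡.cong (_∧ D m) (dec-true (n ℕ.≟ n) refl)) eq

  Full : ℕ → Pred ℕ 0ℓ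
  Full k n = ∀ m → Row (u k) n m

  -- `c` is 1 on the rows in `D` and 0 on the others; a full row on each side of `D` keeps both
  -- parts nonzero.
  splits-full : (∀ k → Unbounded (Full k)) → ∃ λ c → ∀ k → u k ⊓ c ≉ 0# × u k ⊓ - c ≉ 0#
  splits-full unb with D , D-splits ← split-unbounded em Full (λ k full m → u-step k (full m)) unb =
    row-constant D , λ k →
      (let (n , _ , full , Dn) = proj₁ (D-splits k) 0 in
        unbounded-row⇒≉0 n (λ M → M , ℕ.≤-refl , ≡.cong₂ _∧_ (full M) Dn))
    , (let (n , _ , full , Dn) = proj₂ (D-splits k) 0 in
        unbounded-row⇒≉0 n (λ M → M , ℕ.≤-refl , ≡.cong₂ (λ p q → p ∧ not q) (full M) Dn))

  -- Row `n` of `u k` represents 0 in P(ω)/fin.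
  Dead : ℕ → ℕ → Set
  Dead k n = ¬ Unbounded (Row (u k) n)

  Dead-mono : ∀ {k l n} → k ℕ.≤ l → Dead k n → Dead l n
  Dead-mono k≤l dead unb = dead λ M →
    let (m , M≤m , um) = unb M in m , M≤m , u-antitone _ k≤l um

  dead-below : (∀ n → ∃ λ k → Dead k n) → ∀ N → ∃ λ k → ∀ {n} → n ℕ.< N → Dead k n
  dead-below dies zero    = 0 , λ ()
  dead-below dies (suc N) with k , dead ← dead-below dies N | l , N-dead ← dies N =
    k ℕ.⊔ l , λ {n} n<1+N → λ unb → case (ℕ.m≤n⇒m<n∨m≡n (ℕ.s≤s⁻¹ n<1+N)) unb
    where
    case : ∀ {n} → n ℕ.< N ⊎ n ≡ N → Dead (k ℕ.⊔ l) n
    case (inj₁ n<N)  = Dead-mono (ℕ.m≤m⊔n k l) (dead n<N)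
    case (inj₂ refl) = Dead-mono (ℕ.m≤n⊔m k l) N-dead

  -- Suppose `u k` has no full row from `N` on. From `B` on its rows are constant and not full,
  -- hence zero; the finitely many rows before `B` are dead at a common stage `l`. Then the later of
  -- the stages `k` and `l` would be zero.
  full-unbounded : (∀ n → ∃ λ k → Dead k n) → ∀ k → Unbounded (Full k)
  full-unbounded dies k = decidable-stable em λ ¬unb →
    let (N , ¬full)  = ¬Unbounded⇒eventually¬ em ¬unb
        B            = N ℕ.⊔ bound (u k)
        (l , dead)   = dead-below dies B
    in meets≉0 (k ℕ.⊔ l) (bounded-rows⇒≈0 em λ n → dead-row ¬full dead n (ℕ.<-≤-connex n B))
    where
    dead-row : ∀ {N l} → (∀ {n} → N ℕ.≤ n → ¬ Full k n) → (∀ {n} → n ℕ.< N ℕ.⊔ bound (u k) → Dead l n) →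
               ∀ n → n ℕ.< N ℕ.⊔ bound (u k) ⊎ N ℕ.⊔ bound (u k) ℕ.≤ n → Dead (k ℕ.⊔ l) n
    dead-row {N} {l} ¬full dead n (inj₁ n<B) = Dead-mono (ℕ.m≤n⊔m k l) (dead n<B)
    dead-row {N} {l} ¬full dead n (inj₂ B≤n) = Dead-mono (ℕ.m≤m⊔n k l) λ unb →
      let (m , _ , um) = unb 0
          const        = λ m → constant (u k) m (ℕ.m⊔n≤o⇒n≤o N _ B≤n)
      in ¬full (ℕ.m⊔n≤o⇒m≤o N _ B≤n) λ m′ → ≡.trans (const m′) (≡.trans (≡.sym (const m)) um)

  splits : ∃ λ c → ∀ k → u k ⊓ c ≉ 0# × u k ⊓ - c ≉ 0#
  splits with em {P = ∃ λ n → ∀ k → Unbounded (Row (u k) n)}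
  ... | yes (n , unb) = splits-row n unb
  ... | no ¬∃         = splits-full (full-unbounded λ n → ¬∀⇒∃¬ em λ unb → ¬∃ (n , unb))

splitting : EM → Splitting
splitting em e meets≉0 = Splits.splits em e meets≉0

-- The disjoint family `y` in `𝔸`.

0≉1 : 0# ≉ 1#
0≉1 (mod-finite 0≈1) with M , eq ← 0≈1 0 with () ← eq (ℕ.≤-refl {M})

y : ℕ → Element
y n = row-constant λ n′ → does (n′ ℕ.≟ n)

y-diagonal : ∀ n → does (n ℕ.≟ n) ≡ true
y-diagonal n = dec-true (n ℕ.≟ n) refl

y≉0 : ∀ n → y n ≉ 0#
y≉0 n = unbounded-row⇒≉0 n λ M → M , ℕ.≤-refl , y-diagonal n

y-disjoint : ∀ {m n} → m ≢ n → y m ≤ - y n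
y-disjoint {m} {n} m≢n = pointwise-≤ (y m) (- y n) λ n′ _ → lemma (n′ ℕ.≟ m) (n′ ℕ.≟ n)
  where
  lemma : ∀ {n′} (d : Dec (n′ ≡ m)) (d′ : Dec (n′ ≡ n)) → does d ≡ true → not (does d′) ≡ true
  lemma (yes n′≡m) (yes n′≡n) _ = contradiction (≡.trans (≡.sym n′≡m) n′≡n) m≢n
  lemma _          (no _)     _ = refl

-- A row at or beyond `bound a` is constant, so a 1 at its start puts the corresponding `y n` below
-- `a`. If there is none, `a` lives on the rows before `bound a`, and these are removed one at a
-- time.
y-dichotomy : EM → ∀ a → Ideal (λ b → ∃ λ n → b ≈ y n) a ⊎ ∃ λ n → y n ≤ a
y-dichotomy em a with em {P = ∃ λ n → bound a ℕ.≤ n × entry a n 0 ≡ true}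
... | yes (n , b≤n , an≡true) = inj₂ (n , pointwise-≤ (y n) a λ n′ m → lemma m (n′ ℕ.≟ n))
  where
  lemma : ∀ {n′} m (d : Dec (n′ ≡ n)) → does d ≡ true → entry a n′ m ≡ true
  lemma m (yes refl) _ = ≡.trans (constant a m b≤n) an≡true
... | no ¬∃ = inj₁ (below (bound a) a λ {n} {m} b≤n → Bool.¬-not λ anm≡true →
        ¬∃ (n , b≤n , ≡.trans (≡.sym (constant a m b≤n)) anm≡true))
  where
  below : ∀ N b → (∀ {n m} → N ℕ.≤ n → entry b n m ≡ false) → Ideal (λ b → ∃ λ n → b ≈ y n) b
  below zero    b zeros = down
    (pointwise-≤ b 0# λ n m bnm → contradiction (≡.trans (≡.sym bnm) (zeros ℕ.z≤n)) λ ()) bottom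
  -- Splitting `b` along `y N` leaves a remainder that vanishes from row `N` on.
  below (suc N) b zeros = down {b = (b ⊓ - y N) ⊔ y N}
    (pointwise-≤ b ((b ⊓ - y N) ⊔ y N) λ n m → covers (entry b n m) (n ℕ.≟ N))
    (join {b = y N} (below N (b ⊓ - y N) (λ {n} {m} N≤n → vanishes (n ℕ.≟ N) N≤n m))
                    (generator (N , pointwise λ _ _ → refl)))
    where
    covers : ∀ {n} p (d : Dec (n ≡ N)) → p ≡ true → (p ∧ not (does d)) ∨ does d ≡ true
    covers true (yes _) _ = refl
    covers true (no _)  _ = refl
    vanishes : ∀ {n} (d : Dec (n ≡ N)) → N ℕ.≤ n → ∀ m → entry b n m ∧ not (does d) ≡ false
    vanishes (yes _)  _   m = Bool.∧-zeroʳ _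
    vanishes (no n≢N) N≤n m = ≡.cong (_∧ true) (zeros (ℕ.≤∧≢⇒< N≤n (n≢N ∘ ≡.sym)))

-- Coding elements of `𝔸` by binary sequences.

next : ℕ × ℕ → ℕ × ℕ
next (n , zero)  = 0 , suc n
next (n , suc m) = suc n , m

-- Cantor's enumeration along the antidiagonals `n + m = d`, each run through from `(0 , d)` to
-- `(d , 0)`.
unpair : ℕ → ℕ × ℕ
unpair zero    = 0 , 0
unpair (suc k) = next (unpair k)

unpair-onto : ∀ n m → ∃ λ k → unpair k ≡ (n , m)
unpair-onto n m = go (n ℕ.+ m) n m refl
  where
  go : ∀ d n m → n ℕ.+ m ≡ d → ∃ λ k → unpair k ≡ (n , m)
  go zero    zero    zero    _  = 0 , refl
  go (suc d) zero    (suc m) eq with k , p ← go d m 0 (≡.trans (ℕ.+-identityʳ m) (ℕ.suc-injective eq)) =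
    suc k , ≡.cong next p
  go d       (suc n) m       eq with k , p ← go d n (suc m) (≡.trans (ℕ.+-suc n m) eq) =
    suc k , ≡.cong next p

-- Equal elements may have different entries, so extensional choice assigns to each class the code
-- of one representative. Equal codes give representatives with the same entries, as `unpair`
-- reaches every position.
Element≲2^ω : AxiomOfChoice → {X : Setoid 0ℓ 0ℓ} → Inverse (ℕ →-setoid Bool) X → A-setoid ≲ X
Element≲2^ω ac {X} 2^ω↔X = record
  { to        = to
  ; cong      = λ a≈b → Setoid.reflexive X (cong a≈b)
  ; injective = λ {a} {b} eq → ≈-trans (≈-sym (code-≈ a)) (≈-trans (same-code a b eq) (code-≈ b))
  }
  where
  open Inverse 2^ω↔X using (from; from-cong; strictlyInverseʳ) renaming (to to encode)
  Codes : Element → Setoid.Carrier X → Set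
  Codes a x = Σ[ b ∈ Element ] b ≈ a × (∀ k → from x k ≡ entry b (proj₁ (unpair k)) (proj₂ (unpair k)))
  choice = ac A-setoid (Setoid.Carrier X) Codes
    (λ x a≈a′ (b , b≈a , coded) → b , ≈-trans b≈a a≈a′ , coded)
    (λ a → encode (λ k → entry a (proj₁ (unpair k)) (proj₂ (unpair k))) , a
         , pointwise (λ _ _ → refl) , strictlyInverseʳ _)
  open Func (proj₁ choice)
  code : Element → Element
  code a = proj₁ (proj₂ choice a)
  code-≈ : ∀ a → code a ≈ a
  code-≈ a = proj₁ (proj₂ (proj₂ choice a))
  same-code : ∀ a b → Setoid._≈_ X (to a) (to b) → code a ≈ code b
  same-code a b eq = pointwise λ n m →
    let (k , uk) = unpair-onto n m in
    ≡.subst (λ nm → entry (code a) (proj₁ nm) (proj₂ nm) ≡ entry (code b) (proj₁ nm) (proj₂ nm)) uk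
      (≡.trans (≡.sym (proj₂ (proj₂ (proj₂ choice a)) k))
        (≡.trans (from-cong eq k) (proj₂ (proj₂ (proj₂ choice b)) k)))

corollary1p6 : (∀ {ℓ} → ExcludedMiddle ℓ) → AxiomOfChoice →
    ContinuumHypothesis →
    Σ[ A ∈ BooleanAlgebra 0ℓ 0ℓ ]
    Atomless A × IsSmm A ω × IsF A ω × ω <ᶜ ω₁ × IsU A ω₁
corollary1p6 em ac (γ , γ-ω₁ , 2^ω↔γ) =
    𝔸
  , atomless (splitting em)
  , isSmm-ω
  , isF-ω em ac (splitting em) X X-maximal (Identity.inverse (setoid ℕ))
  , ω<ω₁ em ac
  , isU-ω₁ em ac (splitting em) 0≉1 γ γ-ω₁ (Element≲2^ω ac 2^ω↔γ)
  where
  open Cascade em ac y y≉0 y-disjoint (y-dichotomy em) using (isSmm-ω; X; X-maximal)
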